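{- Let $(a_n)_{n\ge 0}$ be the $0/1$ sequence with $a_n=1$ if $n+1$ is a power of $2$ (i.e. $n=2^k-1$ for some integer $k\ge 0$) and $a_n=0$ otherwise. Call a permutation $\pi$ of $\{0,1,\dots,n-1\}$ nimble if for every $i\in\{0,\dots,n-1\}$ the number $i+\pi(i)+1$ is a power of $2$. Then for every integer $n\ge 1$ there exists a unique nimble permutation $\pi_n$ of $\{0,1,\dots,n-1\}$, and $$\det\left(a_{i+j}\right)_{i,j=0}^{n-1}=\operatorname{sgn}(\pi_n)\,a_{0+\pi_n(0)}a_{1+\pi_n(1)}\cdots a_{n-1+\pi_n(n-1)}=(-1)^{\binom{n}{2}}.$$
   Context: $a_n$ coincides with the Catalan number $C_n=\frac{1}{n+1}\binom{2n}{n}$ reduced modulo $2$ and regarded as an integer in $\{0,1\}$. A permutation is nimble exactly when $a_{0+\pi(0)}\cdots a_{n-1+\pi(n-1)}\neq 0$. -}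

module Defs where

open import Algebra.Definitions.RawMonoid using (sum)
open import Data.Bool.Base using (if_then_else_)
open import Data.Fin.Base using (Fin; zero; suc; toℕ)
import Data.Fin.Base as Fin
open import Data.Fin.Permutation
  using (Permutation′; _⟨$⟩ʳ_; _≈_; id; insert; remove; insert-remove)
open import Data.Fin.Properties using (punchIn-injective; _<?_)
open import Data.Integer.Base using (ℤ; 0ℤ; 1ℤ; -1ℤ; _+_; _*_; _^_)
open import Data.Integer.Properties using (*-1-rawMonoid)
open import Data.List.Base
  using (List; []; _∷_; map; foldr; filter; length; allFin; cartesianProduct; cartesianProductWith)
import Data.List.Membership.Setoid as Membership
import Data.List.Membership.Setoid.Properties as Membershipₚ
open import Data.List.Membership.Propositional.Properties using (∈-allFin)
open import Data.List.Relation.Unary.All using ([])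
open import Data.List.Relation.Unary.AllPairs using ([]; _∷_)
open import Data.List.Relation.Unary.Any using (here)
import Data.List.Relation.Unary.Unique.Setoid as Unique
import Data.List.Relation.Unary.Unique.Setoid.Properties as Uniqueₚ
open import Data.List.Relation.Unary.Unique.Propositional.Properties using (allFin⁺)
open import Data.Nat.Base as ℕ using (ℕ; zero; suc)
import Data.Nat.Properties as ℕ
open import Data.Nat.Logarithm using (⌊log₂_⌋; ⌊log₂[2^n]⌋≡n)
open import Data.Product.Base using (∃-syntax; _×_; _,_)
open import Level using (0ℓ)
open import Relation.Binary.Bundles using (Setoid)
open import Relation.Binary.PropositionalEquality
  using (_≡_; refl; sym; trans; cong; cong₂; setoid)
open import Relation.Nullary.Decidable using (Dec; does; map′; _×-dec_)

IsPowerOf2 : ℕ → Set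
IsPowerOf2 m = ∃[ k ] m ≡ 2 ℕ.^ k

isPowerOf2? : ∀ m → Dec (IsPowerOf2 m)
isPowerOf2? m = map′ (⌊log₂ m ⌋ ,_) complete (m ℕ.≟ 2 ℕ.^ ⌊log₂ m ⌋)
  where
  complete : IsPowerOf2 m → m ≡ 2 ℕ.^ ⌊log₂ m ⌋
  complete (k , refl) = cong (2 ℕ.^_) (sym (⌊log₂[2^n]⌋≡n k))

a : ℕ → ℤ
a n = if does (isPowerOf2? (n ℕ.+ 1)) then 1ℤ else 0ℤ

Nimble : ∀ {n} → Permutation′ n → Set
Nimble π = ∀ i → IsPowerOf2 (toℕ i ℕ.+ toℕ (π ⟨$⟩ʳ i) ℕ.+ 1)

∏ : ∀ {n} → (Fin n → ℤ) → ℤ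
∏ = sum *-1-rawMonoid

inversions : ∀ {n} → Permutation′ n → List (Fin n × Fin n)
inversions {n} π =
  filter (λ (i , j) → (i <? j) ×-dec ((π ⟨$⟩ʳ j) <? (π ⟨$⟩ʳ i)))
         (cartesianProduct (allFin n) (allFin n))

sgn : ∀ {n} → Permutation′ n → ℤ
sgn π = -1ℤ ^ length (inversions π)

-- All permutations of Fin n, each listed once up to pointwise equality _≈_
-- (see permutations-complete and permutations-unique): the value at zero is
-- chosen freely, the rest is a permutation of the remaining n points.
permutations : ∀ n → List (Permutation′ n)
permutations zero    = id ∷ []
permutations (suc n) =
  cartesianProductWith (insert zero) (allFin (suc n)) (permutations n)

Matrix : ℕ → Set
Matrix n = Fin n → Fin n → ℤ

-- Leibniz formula.
det : ∀ {n} → Matrix n → ℤ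
det {n} M =
  foldr _+_ 0ℤ (map (λ σ → sgn σ * ∏ (λ i → M i (σ ⟨$⟩ʳ i))) (permutations n))

permutationSetoid : ℕ → Setoid 0ℓ 0ℓ
permutationSetoid n = record
  { Carrier       = Permutation′ n
  ; _≈_           = _≈_
  ; isEquivalence = record
    { refl  = λ _ → refl
    ; sym   = λ p i → sym (p i)
    ; trans = λ p q i → trans (p i) (q i)
    }
  }

insert-cong : ∀ {n} {j k : Fin (suc n)} {π ρ : Permutation′ n} →
              j ≡ k → π ≈ ρ → insert zero j π ≈ insert zero k ρ
insert-cong j≡k π≈ρ zero    = j≡k
insert-cong j≡k π≈ρ (suc i) = cong₂ Fin.punchIn j≡k (π≈ρ i)

insert-injective : ∀ {n} {j k : Fin (suc n)} {π ρ : Permutation′ n} →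
                   insert zero j π ≈ insert zero k ρ → j ≡ k × π ≈ ρ
insert-injective {j = j} eq with refl ← eq zero =
  refl , λ i → punchIn-injective j _ _ (eq (suc i))

permutations-complete : ∀ n (π : Permutation′ n) →
  let open Membership (permutationSetoid n) in π ∈ permutations n
permutations-complete zero    π = here λ ()
permutations-complete (suc n) π =
  Membershipₚ.∈-resp-≈ (permutationSetoid (suc n))
    {x = insert zero (π ⟨$⟩ʳ zero) (remove zero π)} {y = π}
    (insert-remove zero π)
    (Membershipₚ.∈-cartesianProductWith⁺
      (setoid (Fin (suc n))) (permutationSetoid n) (permutationSetoid (suc n))
      (λ {_} {_} {π} {ρ} → insert-cong {π = π} {ρ = ρ})
      (∈-allFin (π ⟨$⟩ʳ zero)) (permutations-complete n (remove zero π)))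

permutations-unique : ∀ n →
  let open Unique (permutationSetoid n) in Unique (permutations n)
permutations-unique zero    = [] ∷ []
permutations-unique (suc n) =
  Uniqueₚ.cartesianProductWith⁺
    (setoid (Fin (suc n))) (permutationSetoid n) (permutationSetoid (suc n))
    (insert zero) (λ {_} {_} {π} {ρ} → insert-injective {π = π} {ρ = ρ})
    (allFin⁺ (suc n)) (permutations-unique n)

{-# OPTIONS --safe #-}

-- If b + m = 2ᵏ with m < b, then a nimble permutation of {0,…,b-1} must send i to 2ᵏ-1-i for all
-- m ≤ i < b: for i + 1 > 2ᵏ⁻¹ the only power of 2 in reach of i + π(i) + 1 is 2ᵏ, and the other i
-- are the images of those under π⁻¹. Hence π restricts to {0,…,m-1}, and existence and uniqueness
-- follow by strong induction. A non-nimble permutation contributes 0 to the determinant.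
--
-- By uniqueness π = π⁻¹. So (i , j) ↦ (π(i) , π(j)) is an involution on the pairs i < j with
-- π(i) < π(j), and it has no fixed point because π(j) = j would make 2j + 1 > 1 a power of 2.
-- Thus an even number of the C(n,2) pairs are not inversions.

module Submission where

open import Defs
open import Data.Bool.Base using (_∧_; if_then_else_)
open import Data.Bool.Properties using (∧-comm)
open import Data.Fin.Base using (Fin; zero; suc; toℕ; fromℕ<)
open import Data.Fin.Permutation
  using (Permutation′; permutation; flip; inverseˡ; inverseʳ; _⟨$⟩ʳ_; _⟨$⟩ˡ_; _≈_)
open import Data.Fin.Properties
  using (toℕ-injective; toℕ<n; toℕ-fromℕ<; ¬∀⟶∃¬; _<?_)
open import Data.Integer.Base as ℤ using (ℤ; 0ℤ; 1ℤ; -1ℤ; _*_; _^_)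
import Data.Integer.Properties as ℤ
open import Data.List.Base
  using (List; _∷_; _++_; map; foldr; filter; length; tabulate; allFin; cartesianProduct)
open import Data.List.Properties using (length-++; filter-++; map-tabulate; filter-≐)
import Data.List.Membership.Setoid as Membership
open import Data.List.Relation.Unary.All as All using (All; []; _∷_)
open import Data.List.Relation.Unary.AllPairs using (_∷_)
open import Data.List.Relation.Unary.Any using (here; there)
import Data.List.Relation.Unary.Unique.Setoid as Unique
open import Data.Nat.Base as ℕ using (ℕ; zero; suc; _+_; _∸_; _≤_; _<_; _≥_)
open import Data.Nat.Combinatorics using (_C_; nC1≡n; nCk+nC[k+1]≡[n+1]C[k+1])
open import Data.Nat.Induction using (<-rec)
import Data.Nat.Properties as ℕ
open import Data.Nat.Tactic.RingSolver using (solve-∀)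
open import Data.Product using (Σ-syntax; ∃; ∃!; ∃-syntax; _×_; _,_; proj₁; proj₂)
open import Function.Base using (_∘_)
open import Level using (Level)
open import Relation.Binary.Bundles using (Setoid)
open import Relation.Binary.PropositionalEquality
  using (_≡_; _≢_; refl; sym; trans; cong; cong₂; subst; subst₂; module ≡-Reasoning)
open import Relation.Nullary.Decidable using (Dec; yes; no; does; dec-true; dec-false; _×-dec_)
open import Relation.Nullary.Negation using (¬_; contradiction)
open import Relation.Unary using (Pred; Decidable)

open import Algebra.Properties.CommutativeMonoid.Sum ℕ.+-0-commutativeMonoid
  using (sum-syntax; sum-cong-≗; ∑-distrib-+; ∑-permute)

private variable
  ℓ p : Level
  b k l m n : ℕ

-- Powers of two

2^k<2^l⇒k<l : 2 ℕ.^ k < 2 ℕ.^ l → k < l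
2^k<2^l⇒k<l p = ℕ.≰⇒> λ l≤k → ℕ.<⇒≱ p (ℕ.^-monoʳ-≤ 2 l≤k)

-- Doubling raises the exponent by one, so each strict inequality bounds one exponent by the other.
-- This identifies a power of 2 that is known only to within a factor of 2.
2^-unique : 2 ℕ.^ k < 2 ℕ.* 2 ℕ.^ l → 2 ℕ.^ l < 2 ℕ.* 2 ℕ.^ k → 2 ℕ.^ k ≡ 2 ℕ.^ l
2^-unique {k} {l} p q = cong (2 ℕ.^_) (ℕ.≤-antisym
  (ℕ.≤-pred (2^k<2^l⇒k<l {k} {suc l} p)) (ℕ.≤-pred (2^k<2^l⇒k<l {l} {suc k} q)))

-- Raising `b` by one lowers `m` by one and keeps `k`, until `m` is 0. Then `suc b` is itself `2ᵏ`,
-- and its successor is completed to `2ᵏ⁺¹` by `m = b`.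
complement-to-2^ : ∀ b → ∃[ m ] ∃[ k ] m < suc b × suc b + m ≡ 2 ℕ.^ k
complement-to-2^ zero    = 0 , 0 , ℕ.z<s , refl
complement-to-2^ (suc b) with complement-to-2^ b
... | zero  , k , _   , eq = b , suc k , ℕ.m≤n⇒m≤1+n ℕ.≤-refl , (begin
  suc (suc b) + b           ≡⟨ double b ⟩
  2 ℕ.* (suc b + 0)         ≡⟨ cong (2 ℕ.*_) eq ⟩
  2 ℕ.* 2 ℕ.^ k             ∎)
  where
  open ≡-Reasoning
  double : ∀ b → suc (suc b) + b ≡ 2 ℕ.* (suc b + 0)
  double = solve-∀
... | suc m , k , m<b , eq =
  m , k , ℕ.m≤n⇒m≤1+n (ℕ.<⇒≤ m<b) , trans (sym (ℕ.+-suc (suc b) m)) eq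

odd-power-of-2 : ∀ x → IsPowerOf2 (x + x + 1) → x ≡ 0
odd-power-of-2 x (zero  , eq) = ℕ.m+n≡0⇒m≡0 x (ℕ.+-cancelʳ-≡ 1 (x + x) 0 eq)
odd-power-of-2 x (suc k , eq) = contradiction
  (trans (sym eq) (ℕ.+-comm (x + x) 1)) (2y≢1+x+x (2 ℕ.^ k) x)
  where
  2y≢1+x+x : ∀ y x → 2 ℕ.* y ≢ suc (x + x)
  2y≢1+x+x y x eq = ℕ.even≢odd y x (trans eq (cong suc (cong (x +_) (sym (ℕ.+-identityʳ x)))))

-- Uniqueness

-- Only the sum of a point and its image matters, so the condition for `π` at `π⁻¹(i)` is the
-- condition for `flip π` at `i`.
flip-nimble : (π : Permutation′ n) → Nimble π → Nimble (flip π)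
flip-nimble π nimble i = subst IsPowerOf2
  (cong (_+ 1) (trans (cong (λ j → toℕ (π ⟨$⟩ˡ i) + toℕ j) (inverseʳ π))
    (ℕ.+-comm (toℕ (π ⟨$⟩ˡ i)) (toℕ i))))
  (nimble (π ⟨$⟩ˡ i))

MapsBelow : ℕ → Permutation′ n → Set
MapsBelow b π = ∀ i → toℕ i < b → toℕ (π ⟨$⟩ʳ i) < b

-- Instead of restricting `π` to a smaller type, the induction keeps `π` on `Fin n` and lowers the
-- bound `b`. Recording both directions lets every argument be repeated for `flip π` without
-- pigeonhole.
StableBelow : ℕ → Permutation′ n → Set
StableBelow b π = MapsBelow b π × MapsBelow b (flip π)

flip-stable : (π : Permutation′ n) → StableBelow b π → StableBelow b (flip π)
flip-stable π (to , from) = from , to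

module _ {n} {b m k} (b≤n : b ≤ n) (m<b : m < b) (b+m≡2^k : b + m ≡ 2 ℕ.^ k) where

  -- The sum `i + π(i) + 1` is less than `2·2ᵏ`, as `i` and `π(i)` are below `b ≤ 2ᵏ`, and more than
  -- half of `2ᵏ`, as `i + 1` already is. The only power of 2 strictly between is `2ᵏ`.
  reflects-upper-half : (π : Permutation′ n) → Nimble π → MapsBelow b π →
    ∀ i → toℕ i < b → 2 ℕ.^ k < 2 ℕ.* suc (toℕ i) → toℕ i + toℕ (π ⟨$⟩ʳ i) + 1 ≡ 2 ℕ.^ k
  reflects-upper-half π nimble below i i<b 2^k<2[1+i] with nimble i
  ... | l , eq = trans eq (2^-unique {l} {k} 2^l<2*2^k 2^k<2*2^l)
    where
    open ℕ.≤-Reasoning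
    j = toℕ (π ⟨$⟩ʳ i)
    b≤2^k : b ≤ 2 ℕ.^ k
    b≤2^k = ℕ.≤-trans (ℕ.m≤m+n b m) (ℕ.≤-reflexive b+m≡2^k)
    2^l<2*2^k : 2 ℕ.^ l < 2 ℕ.* 2 ℕ.^ k
    2^l<2*2^k = begin-strict
      2 ℕ.^ l                ≡⟨ eq ⟨
      toℕ i + j + 1          ≡⟨ ℕ.+-assoc (toℕ i) j 1 ⟩
      toℕ i + (j + 1)        ≡⟨ cong (toℕ i +_) (ℕ.+-comm j 1) ⟩
      toℕ i + suc j          <⟨ ℕ.+-mono-<-≤ i<b (below i i<b) ⟩
      b + b                  ≤⟨ ℕ.+-mono-≤ b≤2^k b≤2^k ⟩
      2 ℕ.^ k + 2 ℕ.^ k      ≡⟨ cong (2 ℕ.^ k +_) (ℕ.+-identityʳ (2 ℕ.^ k)) ⟨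
      2 ℕ.* 2 ℕ.^ k          ∎
    2^k<2*2^l : 2 ℕ.^ k < 2 ℕ.* 2 ℕ.^ l
    2^k<2*2^l = begin-strict
      2 ℕ.^ k                <⟨ 2^k<2[1+i] ⟩
      2 ℕ.* suc (toℕ i)      ≡⟨ cong (2 ℕ.*_) (ℕ.+-comm 1 (toℕ i)) ⟩
      2 ℕ.* (toℕ i + 1)      ≤⟨ ℕ.*-monoʳ-≤ 2 (ℕ.+-monoˡ-≤ 1 (ℕ.m≤m+n (toℕ i) j)) ⟩
      2 ℕ.* (toℕ i + j + 1)  ≡⟨ cong (2 ℕ.*_) eq ⟩
      2 ℕ.* 2 ℕ.^ l          ∎

  -- If `i + 1` is at most half of `2ᵏ`, the mirror point `j = 2ᵏ-1-i` exceeds `i` and so lies in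
  -- the upper half. The previous lemma for `flip π` at `j` gives `π⁻¹(j) = i`, hence `π(i) = j`.
  reflects : (π : Permutation′ n) → Nimble π → StableBelow b π →
    ∀ i → m ≤ toℕ i → toℕ i < b → toℕ i + toℕ (π ⟨$⟩ʳ i) + 1 ≡ 2 ℕ.^ k
  reflects π nimble stable i m≤i i<b with 2 ℕ.^ k ℕ.<? 2 ℕ.* suc (toℕ i)
  ... | yes upper = reflects-upper-half π nimble (proj₁ stable) i i<b upper
  ... | no ¬upper = begin
    toℕ i + toℕ (π ⟨$⟩ʳ i) + 1  ≡⟨ cong (λ x → toℕ i + toℕ x + 1) πi≡j ⟩
    toℕ i + toℕ j + 1           ≡⟨ ℕ.+-comm (toℕ i + toℕ j) 1 ⟩
    suc (toℕ i) + toℕ j         ≡⟨ 1+i+j≡2^k ⟩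
    2 ℕ.^ k                     ∎
    where
    open ≡-Reasoning
    2[1+i]≤2^k : suc (toℕ i) + suc (toℕ i) ≤ 2 ℕ.^ k
    2[1+i]≤2^k = subst (_≤ 2 ℕ.^ k) (cong (suc (toℕ i) +_) (ℕ.+-identityʳ (suc (toℕ i))))
      (ℕ.≮⇒≥ ¬upper)
    1+i≤2^k : suc (toℕ i) ≤ 2 ℕ.^ k
    1+i≤2^k = ℕ.≤-trans (ℕ.m≤m+n _ _) 2[1+i]≤2^k
    -- Here `m ≤ i` enters: it keeps the mirror point below `b`.
    2^k<b+[1+i] : 2 ℕ.^ k < b + suc (toℕ i)
    2^k<b+[1+i] = subst (_< b + suc (toℕ i)) b+m≡2^k (ℕ.+-monoʳ-< b (ℕ.s≤s m≤i))
    j<b : 2 ℕ.^ k ∸ suc (toℕ i) < b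
    j<b = ℕ.+-cancelʳ-< (suc (toℕ i)) _ b
      (subst (_< b + suc (toℕ i)) (sym (ℕ.m∸n+n≡m 1+i≤2^k)) 2^k<b+[1+i])
    j : Fin n
    j = fromℕ< (ℕ.<-≤-trans j<b b≤n)
    toℕ-j : toℕ j ≡ 2 ℕ.^ k ∸ suc (toℕ i)
    toℕ-j = toℕ-fromℕ< (ℕ.<-≤-trans j<b b≤n)
    1+i+j≡2^k : suc (toℕ i) + toℕ j ≡ 2 ℕ.^ k
    1+i+j≡2^k = trans (cong (suc (toℕ i) +_) toℕ-j) (ℕ.m+[n∸m]≡n 1+i≤2^k)
    1+i≤j : suc (toℕ i) ≤ toℕ j
    1+i≤j = ℕ.+-cancelˡ-≤ (suc (toℕ i)) _ _
      (ℕ.≤-trans 2[1+i]≤2^k (ℕ.≤-reflexive (sym 1+i+j≡2^k)))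
    2^k<2[1+j] : 2 ℕ.^ k < 2 ℕ.* suc (toℕ j)
    2^k<2[1+j] = subst₂ _<_ 1+i+j≡2^k (cong (suc (toℕ j) +_) (sym (ℕ.+-identityʳ (suc (toℕ j)))))
      (ℕ.+-mono-≤-< (ℕ.m≤n⇒m≤1+n 1+i≤j) (ℕ.n<1+n (toℕ j)))
    j+π⁻¹j+1≡2^k : toℕ j + toℕ (π ⟨$⟩ˡ j) + 1 ≡ 2 ℕ.^ k
    j+π⁻¹j+1≡2^k = reflects-upper-half (flip π) (flip-nimble π nimble) (proj₂ stable) j
      (subst (_< b) (sym toℕ-j) j<b) 2^k<2[1+j]
    π⁻¹j≡i : π ⟨$⟩ˡ j ≡ i
    π⁻¹j≡i = toℕ-injective (ℕ.+-cancelˡ-≡ (toℕ j) _ _ (ℕ.+-cancelʳ-≡ 1 _ _ (begin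
      toℕ j + toℕ (π ⟨$⟩ˡ j) + 1  ≡⟨ j+π⁻¹j+1≡2^k ⟩
      2 ℕ.^ k                     ≡⟨ 1+i+j≡2^k ⟨
      suc (toℕ i) + toℕ j         ≡⟨ ℕ.+-comm (suc (toℕ i)) (toℕ j) ⟩
      toℕ j + suc (toℕ i)         ≡⟨ cong (toℕ j +_) (ℕ.+-comm 1 (toℕ i)) ⟩
      toℕ j + (toℕ i + 1)         ≡⟨ ℕ.+-assoc (toℕ j) (toℕ i) 1 ⟨
      toℕ j + toℕ i + 1           ∎)))
    πi≡j : π ⟨$⟩ʳ i ≡ j
    πi≡j = trans (cong (π ⟨$⟩ʳ_) (sym π⁻¹j≡i)) (inverseʳ π)

  -- If `i < m` had `π(i) ≥ m`, then `π⁻¹` would reflect `π(i)`, so `π(i) + i + 1 = b + m`. But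
  -- `π(i) < b` and `i + 1 ≤ m` make that sum smaller.
  maps-remainder : (π : Permutation′ n) → Nimble π → StableBelow b π → MapsBelow m π
  maps-remainder π nimble stable i i<m = ℕ.≰⇒> λ m≤πi →
    ℕ.<-irrefl (trans (reflects (flip π) (flip-nimble π nimble) (flip-stable π stable)
                         (π ⟨$⟩ʳ i) m≤πi πi<b) (sym b+m≡2^k)) (begin-strict
      toℕ (π ⟨$⟩ʳ i) + toℕ (π ⟨$⟩ˡ (π ⟨$⟩ʳ i)) + 1
        ≡⟨ cong (λ x → toℕ (π ⟨$⟩ʳ i) + toℕ x + 1) (inverseˡ π) ⟩
      toℕ (π ⟨$⟩ʳ i) + toℕ i + 1    ≡⟨ ℕ.+-assoc (toℕ (π ⟨$⟩ʳ i)) (toℕ i) 1 ⟩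
      toℕ (π ⟨$⟩ʳ i) + (toℕ i + 1)  ≡⟨ cong (toℕ (π ⟨$⟩ʳ i) +_) (ℕ.+-comm (toℕ i) 1) ⟩
      toℕ (π ⟨$⟩ʳ i) + suc (toℕ i)  <⟨ ℕ.+-mono-<-≤ πi<b i<m ⟩
      b + m                         ∎)
    where
    open ℕ.≤-Reasoning
    πi<b = proj₁ stable i (ℕ.<-trans i<m m<b)

  stable-remainder : (π : Permutation′ n) → Nimble π → StableBelow b π → StableBelow m π
  stable-remainder π nimble stable = maps-remainder π nimble stable ,
    maps-remainder (flip π) (flip-nimble π nimble) (flip-stable π stable)

-- From `m` upwards both permutations are the same reflection; below `m` the induction hypothesis
-- applies. Stability is part of the induction predicate because it has to be re-established for
-- `m`.
nimble-unique-below : {π ρ : Permutation′ n} → Nimble π → Nimble ρ → ∀ b → b ≤ n →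
  StableBelow b π → StableBelow b ρ → ∀ i → toℕ i < b → π ⟨$⟩ʳ i ≡ ρ ⟨$⟩ʳ i
nimble-unique-below {n} {π} {ρ} nimble-π nimble-ρ = <-rec _ step
  where
  P : ℕ → Set
  P b = b ≤ n → StableBelow b π → StableBelow b ρ → ∀ i → toℕ i < b → π ⟨$⟩ʳ i ≡ ρ ⟨$⟩ʳ i
  step : ∀ b → (∀ {m} → m < b → P m) → P b
  step (suc b) rec b≤n stable-π stable-ρ i i<b with complement-to-2^ b
  ... | m , k , m<b , eq with toℕ i ℕ.<? m
  ...   | yes i<m = rec m<b (ℕ.≤-trans (ℕ.<⇒≤ m<b) b≤n)
            (stable-remainder {k = k} b≤n m<b eq π nimble-π stable-π)
            (stable-remainder {k = k} b≤n m<b eq ρ nimble-ρ stable-ρ) i i<m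
  ...   | no  i≮m = toℕ-injective (ℕ.+-cancelˡ-≡ (toℕ i) _ _ (ℕ.+-cancelʳ-≡ 1 _ _ (trans
            (reflects {k = k} b≤n m<b eq π nimble-π stable-π i (ℕ.≮⇒≥ i≮m) i<b)
            (sym (reflects {k = k} b≤n m<b eq ρ nimble-ρ stable-ρ i (ℕ.≮⇒≥ i≮m) i<b)))))

nimble-unique : {π ρ : Permutation′ n} → Nimble π → Nimble ρ → π ≈ ρ
nimble-unique {n} {π} {ρ} nimble-π nimble-ρ i =
  nimble-unique-below {π = π} {ρ} nimble-π nimble-ρ n ℕ.≤-refl
    ((λ _ _ → toℕ<n _) , (λ _ _ → toℕ<n _)) ((λ _ _ → toℕ<n _) , (λ _ _ → toℕ<n _)) i (toℕ<n i)

-- Existence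

-- Working with functions on `ℕ`, constrained only below `b`, lets two pieces be glued by a case
-- distinction. Carrying `f (f i) ≡ i` along supplies the inverse of the final permutation.
NimbleInvolutionAt : ℕ → (ℕ → ℕ) → ℕ → Set
NimbleInvolutionAt b f i = f i < b × f (f i) ≡ i × IsPowerOf2 (i + f i + 1)

-- The reflection `i ↦ 2ᵏ-1-i` is an involution of the block from `m` up to the bound, and the
-- induction hypothesis fills in the points below `m`.
nimble-involution : ∀ b → ∃[ f ] (∀ i → i < b → NimbleInvolutionAt b f i)
nimble-involution = <-rec _ step
  where
  step : ∀ b → (∀ {m} → m < b → ∃[ f ] (∀ i → i < m → NimbleInvolutionAt m f i)) →
         ∃[ f ] (∀ i → i < b → NimbleInvolutionAt b f i)
  step zero    rec = (λ i → i) , λ _ ()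
  step (suc b) rec with complement-to-2^ b
  ... | m , k , m<b , eq with rec m<b
  ...   | g , g-nimble = f , f-nimble
    where
    f : ℕ → ℕ
    f i = if does (i ℕ.<? m) then g i else 2 ℕ.^ k ∸ suc i
    f-below : ∀ {i} → i < m → f i ≡ g i
    f-below {i} i<m = cong (if_then g i else 2 ℕ.^ k ∸ suc i) (dec-true (i ℕ.<? m) i<m)
    f-above : ∀ {i} → m ≤ i → f i ≡ 2 ℕ.^ k ∸ suc i
    f-above {i} m≤i =
      cong (if_then g i else 2 ℕ.^ k ∸ suc i) (dec-false (i ℕ.<? m) (ℕ.≤⇒≯ m≤i))
    nimble-at : ∀ i {j} → f i ≡ j → j < suc b × f j ≡ i × IsPowerOf2 (i + j + 1) →
      NimbleInvolutionAt (suc b) f i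
    nimble-at i refl nimble = nimble
    f-nimble : ∀ i → i < suc b → NimbleInvolutionAt (suc b) f i
    f-nimble i i<b with i ℕ.<? m
    ... | yes i<m with g-nimble i i<m
    ...   | gi<m , ggi≡i , power = nimble-at i (f-below i<m)
      (ℕ.<-trans gi<m m<b , trans (f-below gi<m) ggi≡i , power)
    f-nimble i i<b | no i≮m = nimble-at i (f-above m≤i) (j<b , trans (f-above m≤j) (begin
        2 ℕ.^ k ∸ suc j        ≡⟨ cong (_∸ suc j) 1+i+j≡2^k ⟨
        suc (i + j) ∸ suc j    ≡⟨ ℕ.m+n∸n≡m i j ⟩
        i                      ∎) , k , trans (ℕ.+-comm (i + j) 1) 1+i+j≡2^k)
      where
      open ≡-Reasoning
      j = 2 ℕ.^ k ∸ suc i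
      m≤i : m ≤ i
      m≤i = ℕ.≮⇒≥ i≮m
      1+i≤2^k : suc i ≤ 2 ℕ.^ k
      1+i≤2^k = ℕ.≤-trans i<b (ℕ.≤-trans (ℕ.m≤m+n (suc b) m) (ℕ.≤-reflexive eq))
      1+i+j≡2^k : suc i + j ≡ 2 ℕ.^ k
      1+i+j≡2^k = ℕ.m+[n∸m]≡n 1+i≤2^k
      -- As `suc b + m ≡ 2ᵏ`, the reflection swaps the end points `m` and `b` of the block. So
      -- `m ≤ i` gives `j < suc b`, and `i < suc b` gives `m ≤ j`.
      j<b : j < suc b
      j<b = ℕ.+-cancelˡ-< (suc i) _ _ (subst (_< suc i + suc b)
        (trans (ℕ.+-comm m (suc b)) (trans eq (sym 1+i+j≡2^k)))
        (ℕ.+-mono-<-≤ (ℕ.s≤s m≤i) (ℕ.≤-refl {suc b})))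
      m≤j : m ≤ j
      m≤j = ℕ.+-cancelˡ-≤ (suc i) _ _ (ℕ.≤-trans (ℕ.+-monoˡ-≤ m i<b)
        (ℕ.≤-reflexive (trans eq (sym 1+i+j≡2^k))))

nimble-exists : ∀ n → ∃ λ (π : Permutation′ n) → Nimble π
nimble-exists n with nimble-involution n
... | f , f-nimble = permutation F F F-involutive F-involutive , F-nimble
  where
  F : Fin n → Fin n
  F i = fromℕ< (proj₁ (f-nimble (toℕ i) (toℕ<n i)))
  toℕ-F : ∀ i → toℕ (F i) ≡ f (toℕ i)
  toℕ-F i = toℕ-fromℕ< (proj₁ (f-nimble (toℕ i) (toℕ<n i)))
  F-involutive : ∀ i → F (F i) ≡ i
  F-involutive i = toℕ-injective (trans (toℕ-F (F i)) (trans (cong f (toℕ-F i))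
    (proj₁ (proj₂ (f-nimble (toℕ i) (toℕ<n i))))))
  F-nimble : ∀ i → IsPowerOf2 (toℕ i + toℕ (F i) + 1)
  F-nimble i = subst (λ j → IsPowerOf2 (toℕ i + j + 1)) (sym (toℕ-F i))
    (proj₂ (proj₂ (f-nimble (toℕ i) (toℕ<n i))))

nimble-involutive : (π : Permutation′ n) → Nimble π → ∀ i → π ⟨$⟩ʳ (π ⟨$⟩ʳ i) ≡ i
nimble-involutive π nimble i = trans
  (nimble-unique {π = π} {flip π} nimble (flip-nimble π nimble) (π ⟨$⟩ʳ i)) (inverseˡ π)

-- Determinant

module _ (S : Setoid ℓ p) where
  open Setoid S using (Carrier) renaming (_≈_ to _~_; sym to ~-sym; trans to ~-trans)
  open Membership S using (_∈_)
  open Unique S using (Unique)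

  private
    ∑ : (Carrier → ℤ) → List Carrier → ℤ
    ∑ t xs = foldr ℤ._+_ 0ℤ (map t xs)

  ∑-zero : ∀ (t : Carrier → ℤ) {xs} → All (λ x → t x ≡ 0ℤ) xs → ∑ t xs ≡ 0ℤ
  ∑-zero t []       = refl
  ∑-zero t (p ∷ ps) = cong₂ ℤ._+_ p (∑-zero t ps)

  -- Uniqueness makes every entry other than the one matching `x` inequivalent to `x`, so its term
  -- vanishes. A setoid is used because permutations are listed once only up to `_≈_`; hence `t`
  -- must respect the equivalence.
  ∑-singleton-support : ∀ (t : Carrier → ℤ) {x xs} →
    (∀ {y} → x ~ y → t x ≡ t y) → (∀ {y} → ¬ (x ~ y) → t y ≡ 0ℤ) →
    Unique xs → x ∈ xs → ∑ t xs ≡ t x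
  ∑-singleton-support t {x} {y ∷ xs} t-cong t-zero (y∉xs ∷ _) (here x~y) = trans
    (cong₂ ℤ._+_ (sym (t-cong x~y))
      (∑-zero t (All.map (λ y≁z → t-zero (λ x~z → y≁z (~-trans (~-sym x~y) x~z))) y∉xs)))
    (ℤ.+-identityʳ (t x))
  ∑-singleton-support t {x} {y ∷ xs} t-cong t-zero (y∉xs ∷ unique) (there x∈xs) = trans
    (cong₂ ℤ._+_ (t-zero (λ x~y → x∉xs (~-sym x~y)))
      (∑-singleton-support t t-cong t-zero unique x∈xs))
    (ℤ.+-identityˡ (t x))
    where
    x∉xs : ¬ (y ~ x)
    x∉xs y~x = let y≁z , x~z = All.lookupAny y∉xs x∈xs in y≁z (~-trans y~x x~z)

∏-cong : {f g : Fin n → ℤ} → (∀ i → f i ≡ g i) → ∏ f ≡ ∏ g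
∏-cong {zero}  f≗g = refl
∏-cong {suc n} f≗g = cong₂ _*_ (f≗g zero) (∏-cong (f≗g ∘ suc))

∏-one : {f : Fin n → ℤ} → (∀ i → f i ≡ 1ℤ) → ∏ f ≡ 1ℤ
∏-one {zero}  f≗1 = refl
∏-one {suc n} f≗1 = cong₂ _*_ (f≗1 zero) (∏-one (f≗1 ∘ suc))

∏-zero : (f : Fin n → ℤ) → ∀ i → f i ≡ 0ℤ → ∏ f ≡ 0ℤ
∏-zero f zero    f₀≡0 = cong (_* ∏ (f ∘ suc)) f₀≡0
∏-zero f (suc i) fᵢ≡0 = trans (cong (f zero *_) (∏-zero (f ∘ suc) i fᵢ≡0)) (ℤ.*-zeroʳ (f zero))

a≡1 : ∀ x → IsPowerOf2 (x + 1) → a x ≡ 1ℤ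
a≡1 x power = cong (if_then 1ℤ else 0ℤ) (dec-true (isPowerOf2? (x + 1)) power)

a≡0 : ∀ x → ¬ IsPowerOf2 (x + 1) → a x ≡ 0ℤ
a≡0 x ¬power = cong (if_then 1ℤ else 0ℤ) (dec-false (isPowerOf2? (x + 1)) ¬power)

sgn-cong : (π ρ : Permutation′ n) → π ≈ ρ → sgn π ≡ sgn ρ
sgn-cong {n} π ρ π≈ρ = cong (λ xs → -1ℤ ^ length xs) (filter-≐ _ _
  ( (λ {(i , j)} (i<j , p) → i<j , subst₂ (λ x y → toℕ x < toℕ y) (π≈ρ j) (π≈ρ i) p)
  , (λ {(i , j)} (i<j , p) → i<j , subst₂ (λ x y → toℕ x < toℕ y) (sym (π≈ρ j)) (sym (π≈ρ i)) p))
  (cartesianProduct (allFin n) (allFin n)))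

leibnizTerm : Matrix n → Permutation′ n → ℤ
leibnizTerm M σ = sgn σ * ∏ (λ i → M i (σ ⟨$⟩ʳ i))

leibnizTerm-cong : (M : Matrix n) (π ρ : Permutation′ n) → π ≈ ρ → leibnizTerm M π ≡ leibnizTerm M ρ
leibnizTerm-cong M π ρ π≈ρ = cong₂ _*_ (sgn-cong π ρ π≈ρ) (∏-cong (λ i → cong (M i) (π≈ρ i)))

det-single-term : (M : Matrix n) (π : Permutation′ n) →
  (∀ σ → ¬ (π ≈ σ) → leibnizTerm M σ ≡ 0ℤ) → det M ≡ leibnizTerm M π
det-single-term {n} M π vanish = ∑-singleton-support (permutationSetoid n) (leibnizTerm M) {x = π}
  (λ {σ} → leibnizTerm-cong M π σ) (λ {σ} → vanish σ)
  (permutations-unique n) (permutations-complete n π)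

-- Since being a power of 2 is decidable and `Fin n` is finite, failure of nimbleness yields a
-- concrete index, whose factor is 0.
leibnizTerm-not-nimble : (σ : Permutation′ n) → ¬ Nimble σ →
  leibnizTerm (λ i j → a (toℕ i + toℕ j)) σ ≡ 0ℤ
leibnizTerm-not-nimble {n} σ ¬nimble
  with ¬∀⟶∃¬ n _ (λ i → isPowerOf2? (toℕ i + toℕ (σ ⟨$⟩ʳ i) + 1)) ¬nimble
... | i , ¬power = trans
  (cong (sgn σ *_) (∏-zero (λ i → a (toℕ i + toℕ (σ ⟨$⟩ʳ i))) i (a≡0 _ ¬power)))
  (ℤ.*-zeroʳ (sgn σ))

-- Sign

-- The Iverson bracket: counts of pairs become double sums, which can be split and reindexed.
⟦_⟧ : {A : Set p} → Dec A → ℕ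
⟦ A? ⟧ = if does A? then 1 else 0

-- Covering is asked only under `A`, because the comparisons split below are exhaustive only for
-- pairs with `i < j`.
⟦⟧-split : {A P Q : Set} (A? : Dec A) (P? : Dec P) (Q? : Dec Q) →
  (P → ¬ Q) → (A → ¬ P → Q) → ⟦ A? ⟧ ≡ ⟦ A? ×-dec P? ⟧ + ⟦ A? ×-dec Q? ⟧
⟦⟧-split (no  _) _       _       _        _        = refl
⟦⟧-split (yes _) (yes p) (yes q) disjoint _        = contradiction q (disjoint p)
⟦⟧-split (yes _) (yes _) (no  _) _        _        = refl
⟦⟧-split (yes _) (no  _) (yes _) _        _        = refl
⟦⟧-split (yes a) (no ¬p) (no ¬q) _        covering = contradiction (covering a ¬p) ¬q

length-filter-tabulate : {A : Set} {P : Pred A p} (P? : Decidable P) (f : Fin n → A) →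
  length (filter P? (tabulate f)) ≡ ∑[ i < n ] ⟦ P? (f i) ⟧
length-filter-tabulate {n = zero}  P? f = refl
length-filter-tabulate {n = suc n} P? f with P? (f zero) | length-filter-tabulate P? (f ∘ suc)
... | yes _ | eq = cong suc eq
... | no  _ | eq = eq

-- Arbitrary `f` and `g` make the induction possible, which passes to `f ∘ suc`; `allFin` is the
-- case of the identity.
length-filter-cartesianProduct : {A B : Set} {P : Pred (A × B) p} (P? : Decidable P)
  (f : Fin m → A) (g : Fin n → B) →
  length (filter P? (cartesianProduct (tabulate f) (tabulate g)))
    ≡ ∑[ i < m ] ∑[ j < n ] ⟦ P? (f i , g j) ⟧
length-filter-cartesianProduct {m = zero}  P? f g = refl
length-filter-cartesianProduct {m = suc m} {n} P? f g = begin
  length (filter P? (row ++ rest))                         ≡⟨ cong length (filter-++ P? row rest) ⟩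
  length (filter P? row ++ filter P? rest)                 ≡⟨ length-++ (filter P? row) ⟩
  length (filter P? row) + length (filter P? rest)         ≡⟨ cong₂ _+_
    (trans (cong (length ∘ filter P?) (map-tabulate g (f zero ,_)))
      (length-filter-tabulate P? (λ j → f zero , g j)))
    (length-filter-cartesianProduct P? (f ∘ suc) g) ⟩
  ∑[ j < n ] ⟦ P? (f zero , g j) ⟧ + ∑[ i < m ] ∑[ j < n ] ⟦ P? (f (suc i) , g j) ⟧ ∎
  where
  open ≡-Reasoning
  row  = map (f zero ,_) (tabulate g)
  rest = cartesianProduct (tabulate (f ∘ suc)) (tabulate g)

∑∑-distrib-+ : (f g : Fin m → Fin n → ℕ) →
  ∑[ i < m ] ∑[ j < n ] (f i j + g i j) ≡ ∑[ i < m ] ∑[ j < n ] f i j + ∑[ i < m ] ∑[ j < n ] g i j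
∑∑-distrib-+ {m} {n} f g = trans (sum-cong-≗ (λ i → ∑-distrib-+ (f i) (g i)))
  (∑-distrib-+ (λ i → ∑[ j < n ] f i j) (λ i → ∑[ j < n ] g i j))

∑∑-cong : {f g : Fin m → Fin n → ℕ} → (∀ i j → f i j ≡ g i j) →
  ∑[ i < m ] ∑[ j < n ] f i j ≡ ∑[ i < m ] ∑[ j < n ] g i j
∑∑-cong f≗g = sum-cong-≗ (λ i → sum-cong-≗ (f≗g i))

∑∑-permute : (f : Fin n → Fin n → ℕ) (π : Permutation′ n) →
  ∑[ i < n ] ∑[ j < n ] f i j ≡ ∑[ i < n ] ∑[ j < n ] f (π ⟨$⟩ʳ i) (π ⟨$⟩ʳ j)
∑∑-permute {n} f π = trans (∑-permute (λ i → ∑[ j < n ] f i j) π)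
  (sum-cong-≗ (λ i → ∑-permute (f (π ⟨$⟩ʳ i)) π))

∑1≡n : ∀ n → ∑[ i < n ] 1 ≡ n
∑1≡n zero    = refl
∑1≡n (suc n) = cong suc (∑1≡n n)

∑∑[i<j]≡nC2 : ∀ n → ∑[ i < n ] ∑[ j < n ] ⟦ i <? j ⟧ ≡ n C 2
∑∑[i<j]≡nC2 zero    = refl
∑∑[i<j]≡nC2 (suc n) = begin
  -- By computation, row 0 contributes its `n` pairs `(0 , suc j)`, column 0 contributes nothing,
  -- and the remaining block is the sum for `n`. Pascal's rule then finishes.
  ∑[ j < n ] 1 + ∑[ i < n ] ∑[ j < n ] ⟦ i <? j ⟧  ≡⟨ cong₂ _+_ (∑1≡n n) (∑∑[i<j]≡nC2 n) ⟩
  n + n C 2                                        ≡⟨ cong (_+ n C 2) (nC1≡n n) ⟨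
  n C 1 + n C 2                                    ≡⟨ nCk+nC[k+1]≡[n+1]C[k+1] n 1 ⟩
  suc n C 2                                        ∎
  where open ≡-Reasoning

module _ (π : Permutation′ n) (nimble : Nimble π) where

  private
    ascending? : ∀ i j → Dec (toℕ i < toℕ j × toℕ (π ⟨$⟩ʳ i) < toℕ (π ⟨$⟩ʳ j))
    ascending? i j = (i <? j) ×-dec ((π ⟨$⟩ʳ i) <? (π ⟨$⟩ʳ j))

    -- The non-inversions are split by whether `π` moves the larger index `j` up or down. The
    -- involution on pairs exchanges the two classes, which makes their total even.
    inversion descending-image ascending-image : Fin n → Fin n → ℕ
    inversion        i j = ⟦ (i <? j) ×-dec ((π ⟨$⟩ʳ j) <? (π ⟨$⟩ʳ i)) ⟧
    ascending-image  i j = ⟦ ascending? i j ×-dec (j <? (π ⟨$⟩ʳ j)) ⟧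
    descending-image i j = ⟦ ascending? i j ×-dec ((π ⟨$⟩ʳ j) <? j) ⟧

  -- The point 0 must be excepted: it can be fixed, since 1 is a power of 2.
  nimble-no-fixed-point : ∀ j → toℕ j ≢ 0 → toℕ (π ⟨$⟩ʳ j) ≢ toℕ j
  nimble-no-fixed-point j j≢0 πj≡j =
    j≢0 (odd-power-of-2 (toℕ j) (subst (λ x → IsPowerOf2 (toℕ j + x + 1)) πj≡j (nimble j)))

  classify-pair : ∀ i j → ⟦ i <? j ⟧ ≡ inversion i j + (ascending-image i j + descending-image i j)
  classify-pair i j = trans
    (⟦⟧-split (i <? j) ((π ⟨$⟩ʳ j) <? (π ⟨$⟩ʳ i)) ((π ⟨$⟩ʳ i) <? (π ⟨$⟩ʳ j)) ℕ.<-asym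
      (λ i<j πj≮πi → ℕ.≤∧≢⇒< (ℕ.≮⇒≥ πj≮πi)
        (λ πi≡πj → ℕ.<-irrefl (cong toℕ (injective (toℕ-injective πi≡πj))) i<j)))
    (cong (inversion i j +_)
      (⟦⟧-split (ascending? i j) (j <? (π ⟨$⟩ʳ j)) ((π ⟨$⟩ʳ j) <? j) ℕ.<-asym
        -- As the larger index, `j` is nonzero and hence not fixed; the smaller index `i` could be
        -- 0.
        (λ (i<j , _) j≮πj → ℕ.≤∧≢⇒< (ℕ.≮⇒≥ j≮πj) (nimble-no-fixed-point j (ℕ.m<n⇒n≢0 i<j)))))
    where
    injective : π ⟨$⟩ʳ i ≡ π ⟨$⟩ʳ j → i ≡ j
    injective πi≡πj = trans (sym (inverseˡ π)) (trans (cong (π ⟨$⟩ˡ_) πi≡πj) (inverseˡ π))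

  -- Since `π` is an involution, passing to images swaps `i < j` with `π(i) < π(j)` and turns
  -- `j < π(j)` into `π(j) < j`. Reindexing by `π` then shows the two classes to be equally large.
  images-exchanged : ∀ i j → ascending-image (π ⟨$⟩ʳ i) (π ⟨$⟩ʳ j) ≡ descending-image i j
  images-exchanged i j
    rewrite nimble-involutive π nimble i | nimble-involutive π nimble j
    = cong (λ x → if x ∧ does ((π ⟨$⟩ʳ j) <? j) then 1 else 0)
        (∧-comm (does ((π ⟨$⟩ʳ i) <? (π ⟨$⟩ʳ j))) (does (i <? j)))

  nC2≡inversions+even : ∃[ e ] n C 2 ≡ length (inversions π) + 2 ℕ.* e
  nC2≡inversions+even = e , (begin
    n C 2                              ≡⟨ ∑∑[i<j]≡nC2 n ⟨
    ∑[ i < n ] ∑[ j < n ] ⟦ i <? j ⟧   ≡⟨ ∑∑-cong classify-pair ⟩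
    ∑[ i < n ] ∑[ j < n ] (inversion i j + (ascending-image i j + descending-image i j))
      ≡⟨ ∑∑-distrib-+ inversion (λ i j → ascending-image i j + descending-image i j) ⟩
    ∑[ i < n ] ∑[ j < n ] inversion i j +
      ∑[ i < n ] ∑[ j < n ] (ascending-image i j + descending-image i j)
      ≡⟨ cong₂ _+_ (sym (length-filter-cartesianProduct {m = n} {n = n}
             (λ (i , j) → (i <? j) ×-dec ((π ⟨$⟩ʳ j) <? (π ⟨$⟩ʳ i))) (λ i → i) (λ j → j)))
           (∑∑-distrib-+ ascending-image descending-image) ⟩
    length (inversions π) + (e + ∑[ i < n ] ∑[ j < n ] descending-image i j)
      ≡⟨ cong (λ x → length (inversions π) + (e + x))
           (trans (∑∑-permute ascending-image π) (∑∑-cong images-exchanged)) ⟨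
    length (inversions π) + (e + e)
      ≡⟨ cong (λ x → length (inversions π) + (e + x)) (ℕ.+-identityʳ e) ⟨
    length (inversions π) + 2 ℕ.* e    ∎)
    where
    open ≡-Reasoning
    -- Half the number of non-inversions.
    e = ∑[ i < n ] ∑[ j < n ] ascending-image i j

  sgn-nimble : sgn π ≡ -1ℤ ^ (n C 2)
  sgn-nimble with nC2≡inversions+even
  ... | e , eq = sym (begin
    -1ℤ ^ (n C 2)                              ≡⟨ cong (-1ℤ ^_) eq ⟩
    -1ℤ ^ (length (inversions π) + 2 ℕ.* e)    ≡⟨ ℤ.^-distribˡ-+-* -1ℤ (length (inversions π)) (2 ℕ.* e) ⟩
    sgn π * -1ℤ ^ (2 ℕ.* e)                    ≡⟨ cong (sgn π *_) (ℤ.^-*-assoc -1ℤ 2 e) ⟨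
    -- The base `-1ℤ ^ 2` has computed to `1ℤ`.
    sgn π * 1ℤ ^ e                             ≡⟨ cong (sgn π *_) (ℤ.^-zeroˡ e) ⟩
    sgn π * 1ℤ                                 ≡⟨ ℤ.*-identityʳ (sgn π) ⟩
    sgn π                                      ∎)
    where open ≡-Reasoning

theorem1p1 : (n : ℕ) → n ≥ 1 →
    Σ[ (π , _) ∈ ∃! (_≈_ {n} {n}) Nimble ]
    (det {n} (λ i j → a (toℕ i + toℕ j))
    ≡ sgn π * ∏ (λ i → a (toℕ i + toℕ (π ⟨$⟩ʳ i))))
    × (sgn π * ∏ (λ i → a (toℕ i + toℕ (π ⟨$⟩ʳ i))) ≡ -1ℤ ^ (n C 2))
theorem1p1 n _ with nimble-exists n
... | π , nimble = (π , nimble , λ {ρ} → nimble-unique {π = π} {ρ} nimble)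
  , det-single-term (λ i j → a (toℕ i + toℕ j)) π
      (λ σ π≉σ → leibnizTerm-not-nimble σ
        (λ nimble-σ → π≉σ (nimble-unique {π = π} {σ} nimble nimble-σ)))
  , trans (cong (sgn π *_) (∏-one (λ i → a≡1 _ (nimble i))))
      (trans (ℤ.*-identityʳ (sgn π)) (sgn-nimble π nimble))
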